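{- For every integer $n\geq 5$ we have $\mathrm{sat}^*(n,\mathcal A_5)=4n-2$.
   Context: A family $\mathcal F$ of subsets of $[n]=\{1,\ldots,n\}$ is called $k$-antichain saturated if $\mathcal F$ does not contain $k$ pairwise incomparable (with respect to inclusion) sets, but for every set $X\subseteq[n]$ with $X\notin\mathcal F$, the family $\mathcal F\cup\{X\}$ contains $k$ pairwise incomparable sets. $\mathrm{sat}^*(n,\mathcal A_k)$ denotes the minimum size of a $k$-antichain saturated family of subsets of $[n]$. -}

module Defs where

open import Data.Nat using (ℕ)
open import Data.Fin.Subset using (Subset; _⊆_)
open import Data.List using (List; _∷_; length)
open import Data.List.Membership.Propositional using (_∈_; _∉_)
open import Data.List.Relation.Unary.All using (All)
open import Data.List.Relation.Unary.AllPairs using (AllPairs)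
open import Data.List.Relation.Unary.Unique.Propositional using (Unique)
open import Data.Product using (_×_; Σ; ∃-syntax)
open import Relation.Nullary using (¬_)

-- A family of subsets of [n] is a duplicate-free list of subsets
-- (Subset n = characteristic vectors over Fin n); its size is the length.

Incomparable : ∀ {n} → Subset n → Subset n → Set
Incomparable A B = ¬ (A ⊆ B) × ¬ (B ⊆ A)

ContainsAntichain : ∀ {n} → ℕ → List (Subset n) → Set
ContainsAntichain {n} k 𝓕 =
  ∃[ L ] (length L ≡ k × All (_∈ 𝓕) L × AllPairs Incomparable L)
  where open import Relation.Binary.PropositionalEquality using (_≡_)

AntichainSaturated : ∀ {n} → ℕ → List (Subset n) → Set
AntichainSaturated {n} k 𝓕 =
  Unique 𝓕 × ¬ ContainsAntichain k 𝓕 ×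
  ((X : Subset n) → X ∉ 𝓕 → ContainsAntichain k (X ∷ 𝓕))

SatStarIs : ℕ → ℕ → ℕ → Set
SatStarIs n k m =
  (Σ (List (Subset n)) λ 𝓕 → AntichainSaturated k 𝓕 × length 𝓕 ≡ m) ×
  ((𝓕 : List (Subset n)) → AntichainSaturated k 𝓕 → m ≤ length 𝓕)
  where open import Relation.Binary.PropositionalEquality using (_≡_)
        open import Data.Nat using (_≤_)

{-# OPTIONS --safe #-}

-- A family without five pairwise incomparable sets has at most four sets on each
-- level and one on each of the levels 0 and n, hence at most 4n − 2 sets.  So it
-- suffices that a saturated family 𝓕 has four sets on each level 0 < j < n; a
-- family of size 4n − 2 is then obtained by saturating the empty one greedily.
--
-- The 4-antichains of 𝓕 form a lattice, ordered by A ≼ B if every a ∈ A lies below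
-- some b ∈ B.  Along it, at least as many sets of 𝓕 on level j lie below A as there
-- are a ∈ A with |a| ≥ j.  Indeed, if B covers A then by saturation 𝓕 contains every
-- X with a ⊆ X ⊆ b, a ∈ A, b ∈ B: otherwise a 4-antichain incomparable to X,
-- joined with A and met with B, would lie strictly between A and B.  Hence each b
-- that crosses level j is the union of the sets X on level j newly below B that it
-- contains.  These collections of X's form an antichain in the power set of the set
-- U of all new X's, and an antichain of nonempty subsets of U of size at most four
-- has at most |U| members, because a power set of a 3-set has width 3.  The minimal
-- 4-antichain is treated in the same way, and for the maximal one the dual argument
-- produces the missing sets of level j above it.
module Submission where

open import Defs
import Data.Bool.Properties as Bool
open import Data.Empty using (⊥; ⊥-elim)
open import Data.Fin as Fin using (Fin; zero; suc)
import Data.Fin.Properties as Fin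
open import Data.Fin.Subset as Subset using (Subset; inside; outside; _⊆_; ∣_∣; ⁅_⁆; ∁; _∪_)
open import Data.Fin.Subset.Properties
open import Data.List using (List; []; _∷_; _++_; map; length; filter; lookup; take; tabulate)
open import Data.List.Membership.Propositional using (_∈_; _∉_; find; lose)
open import Data.List.Membership.Propositional.Properties using (∈-filter⁺; ∈-filter⁻; ∈-++⁺ˡ; ∈-++⁺ʳ; ∈-++⁻; ∈-map⁺; ∈-lookup)
import Data.List.Membership.DecPropositional as DecMembership
open import Data.List.Properties using (length-++; length-map; length-take; length-filter; length-tabulate; filter-all; filter-some)
open import Data.List.Relation.Unary.All as All using (All; []; _∷_)
import Data.List.Relation.Unary.All.Properties as All
open import Data.List.Relation.Unary.AllPairs as AllPairs using (AllPairs; []; _∷_)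
import Data.List.Relation.Unary.AllPairs.Properties as AllPairs
open import Data.List.Relation.Unary.Any as Any using (Any; here; there)
open import Data.List.Relation.Unary.Unique.Propositional using (Unique)
open import Data.Nat using (ℕ; zero; suc; _+_; _*_; _∸_; _≤_; _<_; z≤n; s≤s; _≤?_; _<?_; _≟_)
open import Data.Nat.Properties hiding (_≟_; _≤?_; _<?_)
open import Algebra.Properties.CommutativeSemigroup +-commutativeSemigroup using () renaming (interchange to +-interchange)
open import Data.Product using (∃-syntax; _×_; _,_; proj₁; proj₂)
open import Data.Sum using (_⊎_; inj₁; inj₂; [_,_]′; swap)
open import Data.Vec as Vec using ([]; _∷_)
import Data.Vec.Properties as Vec
open import Function using (_∘_; id)
open import Relation.Binary.PropositionalEquality using (_≡_; _≢_; refl; sym; trans; cong; cong₂; subst)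
open import Relation.Nullary using (¬_; Dec; yes; no; does)
open import Relation.Nullary.Decidable using (_×-dec_; _⊎-dec_; _→-dec_; ¬?; decidable-stable; map′; dec-true; dec-false; from-yes; toSum)
open import Relation.Unary using (Decidable)
open import Relation.Unary.Properties using (U?)

private
  variable
    n : ℕ

-- Counting in filtered lists.

module _ {A : Set} {P Q R : A → Set} (P? : Decidable P) (Q? : Decidable Q) (R? : Decidable R) where

  filter-disjoint : (∀ {x} → P x → R x) → (∀ {x} → Q x → R x) → (∀ {x} → P x → ¬ Q x) →
                    ∀ xs → length (filter P? xs) + length (filter Q? xs) ≤ length (filter R? xs)
  filter-disjoint PR QR PQ [] = z≤n
  filter-disjoint PR QR PQ (x ∷ xs) with P? x | Q? x | R? x | filter-disjoint PR QR PQ xs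
  ... | yes p | yes q | _     | _  = ⊥-elim (PQ p q)
  ... | yes p | no _  | no ¬r | _  = ⊥-elim (¬r (PR p))
  ... | no _  | yes q | no ¬r | _  = ⊥-elim (¬r (QR q))
  ... | yes _ | no _  | yes _ | ih = s≤s ih
  ... | no _  | yes _ | yes _ | ih = ≤-trans (≤-reflexive (+-suc _ _)) (s≤s ih)
  ... | no _  | no _  | yes _ | ih = m≤n⇒m≤1+n ih
  ... | no _  | no _  | no _  | ih = ih

  filter-cover : (∀ {x} → R x → P x ⊎ Q x) →
                 ∀ xs → length (filter R? xs) ≤ length (filter P? xs) + length (filter Q? xs)
  filter-cover f [] = z≤n
  filter-cover f (x ∷ xs) with P? x | Q? x | R? x | filter-cover f xs
  ... | yes _ | yes _ | yes _ | ih = s≤s (≤-trans (m≤n⇒m≤1+n ih) (≤-reflexive (sym (+-suc _ _))))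
  ... | yes _ | no _  | yes _ | ih = s≤s ih
  ... | no _  | yes _ | yes _ | ih = ≤-trans (s≤s ih) (≤-reflexive (sym (+-suc _ _)))
  ... | no ¬p | no ¬q | yes r | _  = ⊥-elim ([ ¬p , ¬q ]′ (f r))
  ... | yes _ | yes _ | no _  | ih = m≤n⇒m≤1+n (≤-trans ih (+-monoʳ-≤ (length (filter P? xs)) (n≤1+n _)))
  ... | yes _ | no _  | no _  | ih = m≤n⇒m≤1+n ih
  ... | no _  | yes _ | no _  | ih = ≤-trans ih (+-monoʳ-≤ (length (filter P? xs)) (n≤1+n _))
  ... | no _  | no _  | no _  | ih = ih

length-filter-cover : {A : Set} {P Q : A → Set} (P? : Decidable P) (Q? : Decidable Q) →
                      (∀ x → P x ⊎ Q x) →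
                      ∀ xs → length xs ≤ length (filter P? xs) + length (filter Q? xs)
length-filter-cover P? Q? f xs = subst (λ l → length l ≤ length (filter P? xs) + length (filter Q? xs)) (filter-all U? (All.universal-U xs))
  (filter-cover P? Q? U? (λ {x} _ → f x) xs)

AllPairs-lookup : {A : Set} {R : A → A → Set} {xs : List A} → AllPairs R xs →
                  ∀ {i k} → i Fin.< k → R (lookup xs i) (lookup xs k)
AllPairs-lookup {xs = x ∷ xs} (p ∷ ps) {zero}  {suc k} _         = All.lookup p (∈-lookup {xs = xs} k)
AllPairs-lookup (p ∷ ps) {suc i} {suc k} (s≤s i<k) = AllPairs-lookup ps i<k

-- Subsets of [n]: comparability and interpolation.

infix 4 _≟ˢ_

_≟ˢ_ : (X Y : Subset n) → Dec (X ≡ Y)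
_≟ˢ_ = Vec.≡-dec Bool._≟_

⊈⇒∃ : (X Y : Subset n) → ¬ X ⊆ Y → ∃[ x ] (x Subset.∈ X × x Subset.∉ Y)
⊈⇒∃ {n} X Y X⊈Y with Fin.¬∀⟶∃¬ n (λ x → x Subset.∈ X → x Subset.∈ Y) (λ x → (x ∈? X) →-dec (x ∈? Y)) (λ f → X⊈Y (λ {x} → f x))
... | x , ¬h = x , decidable-stable (x ∈? X) (λ x∉X → ¬h (⊥-elim ∘ x∉X)) , λ x∈Y → ¬h (λ _ → x∈Y)

⊆∧∣≥∣⇒≡ : {X Y : Subset n} → X ⊆ Y → ∣ Y ∣ ≤ ∣ X ∣ → X ≡ Y
⊆∧∣≥∣⇒≡ {X = X} {Y} X⊆Y ∣Y∣≤∣X∣ with Y ⊆? X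
... | yes Y⊆X = ⊆-antisym X⊆Y Y⊆X
... | no  Y⊈X = ⊥-elim (<⇒≱ (p⊂q⇒∣p∣<∣q∣ (X⊆Y , ⊈⇒∃ Y X Y⊈X)) ∣Y∣≤∣X∣)

≢∧∣≡∣⇒incomparable : {X Y : Subset n} → X ≢ Y → ∣ X ∣ ≡ ∣ Y ∣ → Incomparable X Y
≢∧∣≡∣⇒incomparable {X = X} {Y} X≢Y e =
  (λ X⊆Y → X≢Y (⊆∧∣≥∣⇒≡ {X = X} {Y} X⊆Y (≤-reflexive (sym e)))) ,
  (λ Y⊆X → X≢Y (sym (⊆∧∣≥∣⇒≡ {X = Y} {X} Y⊆X (≤-reflexive e))))

∣p∪q∣≤∣p∣+∣q∣ : (p q : Subset n) → ∣ p ∪ q ∣ ≤ ∣ p ∣ + ∣ q ∣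
∣p∪q∣≤∣p∣+∣q∣ [] [] = z≤n
∣p∪q∣≤∣p∣+∣q∣ (outside ∷ p) (outside ∷ q) = ∣p∪q∣≤∣p∣+∣q∣ p q
∣p∪q∣≤∣p∣+∣q∣ (outside ∷ p) (inside  ∷ q) = ≤-trans (s≤s (∣p∪q∣≤∣p∣+∣q∣ p q)) (≤-reflexive (sym (+-suc _ _)))
∣p∪q∣≤∣p∣+∣q∣ (inside  ∷ p) (outside ∷ q) = s≤s (∣p∪q∣≤∣p∣+∣q∣ p q)
∣p∪q∣≤∣p∣+∣q∣ (inside  ∷ p) (inside  ∷ q) = s≤s (≤-trans (∣p∪q∣≤∣p∣+∣q∣ p q) (+-monoʳ-≤ ∣ p ∣ (n≤1+n _)))

interpolate : (a b : Subset n) (j : ℕ) → a ⊆ b → ∣ a ∣ ≤ j → j ≤ ∣ b ∣ →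
              ∃[ X ] (a ⊆ X × X ⊆ b × ∣ X ∣ ≡ j)
interpolate [] [] zero a⊆b _ _ = [] , id , id , refl
interpolate (inside ∷ a) (outside ∷ b) j a⊆b _ _ with () ← a⊆b Vec.here
interpolate (outside ∷ a) (outside ∷ b) j a⊆b l h with interpolate a b j (drop-∷-⊆ a⊆b) l h
... | X , aX , Xb , e = outside ∷ X , s⊆s aX , s⊆s Xb , e
interpolate (inside ∷ a) (inside ∷ b) (suc j) a⊆b (s≤s l) (s≤s h) with interpolate a b j (drop-∷-⊆ a⊆b) l h
... | X , aX , Xb , e = inside ∷ X , s⊆s aX , s⊆s Xb , cong suc e
-- A free element is left out as long as the rest of `b` is large enough; otherwise `j` is the size
-- of `inside ∷ b` itself.
interpolate (outside ∷ a) (inside ∷ b) j a⊆b l h with j ≤? ∣ b ∣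
... | no  j≰b = inside ∷ b , a⊆b , id , ≤-antisym (≰⇒> j≰b) h
... | yes j≤b with interpolate a b j (drop-∷-⊆ a⊆b) l j≤b
...   | X , aX , Xb , e = outside ∷ X , s⊆s aX , out⊆ Xb , e

-- Interpolating from `a ∪ ⁅ x ⁆` forces `x` into the set; the extra element is why `∣ a ∣ < j` is
-- strict. It shows that `b` is a union of j-sets above `a`.
interpolate-∋ : {a b : Subset n} {j : ℕ} {x : Fin n} → a ⊆ b → x Subset.∈ b → ∣ a ∣ < j → j ≤ ∣ b ∣ →
                ∃[ X ] (a ⊆ X × X ⊆ b × ∣ X ∣ ≡ j × x Subset.∈ X)
interpolate-∋ {a = a} {b} {j} {x} a⊆b x∈b ∣a∣<j j≤∣b∣
  with interpolate (a ∪ ⁅ x ⁆) b j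
         (λ y∈ → [ a⊆b , (λ y∈x → subst (Subset._∈ b) (sym (x∈⁅y⁆⇒x≡y x y∈x)) x∈b) ]′ (x∈p∪q⁻ a ⁅ x ⁆ y∈))
         (≤-trans (∣p∪q∣≤∣p∣+∣q∣ a ⁅ x ⁆) (≤-trans (≤-reflexive (trans (cong (∣ a ∣ +_) (∣⁅x⁆∣≡1 x)) (+-comm _ 1))) ∣a∣<j))
         j≤∣b∣
... | X , l , u , e = X , (λ y∈ → l (p⊆p∪q ⁅ x ⁆ y∈)) , u , e , l (q⊆p∪q a ⁅ x ⁆ (x∈⁅x⁆ x))

-- Interpolating below the complement of `⁅ x ⁆`, which has n - 1 elements, keeps `x` out. It shows
-- that `a` is an intersection of j-sets.
interpolate-∌ : {a : Subset n} {j : ℕ} {x : Fin n} → x Subset.∉ a → ∣ a ∣ ≤ j → j < n →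
                ∃[ X ] (a ⊆ X × ∣ X ∣ ≡ j × x Subset.∉ X)
interpolate-∌ {n = suc m} {a} {j} {x} x∉a ∣a∣≤j (s≤s j≤m)
  with interpolate a (∁ ⁅ x ⁆) j
         (λ y∈a → x∉p⇒x∈∁p (λ y∈x → x∉a (subst (Subset._∈ a) (x∈⁅y⁆⇒x≡y x y∈x) y∈a)))
         ∣a∣≤j
         (≤-trans j≤m (≤-reflexive (sym (trans (∣∁p∣≡n∸∣p∣ ⁅ x ⁆) (cong (suc m ∸_) (∣⁅x⁆∣≡1 x))))))
... | X , l , u , e = X , l , e , λ x∈X → x∈∁p⇒x∉p (u x∈X) (x∈⁅x⁆ x)

-- The width of small power sets.

-- A partition of the power set of a k-set, 1 ≤ k ≤ 3, into k chains.
chain₁ : Subset 1 → Fin 1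
chain₁ _ = zero

chain₂ : Subset 2 → Fin 2
chain₂ (outside ∷ inside ∷ []) = suc zero
chain₂ _                       = zero

chain₃ : Subset 3 → Fin 3
chain₃ (outside ∷ inside  ∷ _      ∷ []) = suc zero
chain₃ (outside ∷ outside ∷ inside ∷ []) = suc (suc zero)
chain₃ (inside  ∷ outside ∷ inside ∷ []) = suc (suc zero)
chain₃ _                                 = zero

subsets : (n : ℕ) → List (Subset n)
subsets zero    = [] ∷ []
subsets (suc n) = map (inside ∷_) (subsets n) ++ map (outside ∷_) (subsets n)

∈-subsets : (X : Subset n) → X ∈ subsets n
∈-subsets [] = here refl
∈-subsets (inside  ∷ X) = ∈-++⁺ˡ (∈-map⁺ _ (∈-subsets X))
∈-subsets {suc n} (outside ∷ X) = ∈-++⁺ʳ (map (inside ∷_) (subsets n)) (∈-map⁺ _ (∈-subsets X))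

Comparable : Subset n → Subset n → Set
Comparable X Y = X ⊆ Y ⊎ Y ⊆ X

-- Quantifying over the list of all subsets makes this decidable, so the three instances are checked
-- by evaluation.
IsChainPartition : ∀ {k} → (Subset n → Fin k) → Set
IsChainPartition {n} f = All (λ X → All (λ Y → f X ≡ f Y → Comparable X Y) (subsets n)) (subsets n)

isChainPartition? : ∀ {k} (f : Subset n → Fin k) → Dec (IsChainPartition f)
isChainPartition? {n} f = All.all? (λ X → All.all? (λ Y → (f X Fin.≟ f Y) →-dec ((X ⊆? Y) ⊎-dec (Y ⊆? X))) (subsets n)) (subsets n)

chain₁-partition : IsChainPartition chain₁
chain₁-partition = from-yes (isChainPartition? chain₁)

chain₂-partition : IsChainPartition chain₂
chain₂-partition = from-yes (isChainPartition? chain₂)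

chain₃-partition : IsChainPartition chain₃
chain₃-partition = from-yes (isChainPartition? chain₃)

chainPartition-bound : ∀ {k} (f : Subset n → Fin k) → IsChainPartition f →
                       (L : List (Subset n)) → AllPairs Incomparable L → length L ≤ k
chainPartition-bound {k = k} f part L anti with length L ≤? k
... | yes le = le
... | no ¬le with Fin.pigeonhole (≰⇒> ¬le) (f ∘ lookup L)
...   | i , l , i<l , eq with All.lookup (All.lookup part (∈-subsets (lookup L i))) (∈-subsets (lookup L l)) eq
...     | inj₁ le = ⊥-elim (proj₁ (AllPairs-lookup anti i<l) le)
...     | inj₂ ge = ⊥-elim (proj₂ (AllPairs-lookup anti i<l) ge)

-- The range of `k` is exact: the power set of the empty set has width 1, that of a 4-set already
-- width 6.
antichain-bound : ∀ {k} → 1 ≤ k → k ≤ 3 → (L : List (Subset k)) → AllPairs Incomparable L → length L ≤ k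
antichain-bound {1} _ _ = chainPartition-bound chain₁ chain₁-partition
antichain-bound {2} _ _ = chainPartition-bound chain₂ chain₂-partition
antichain-bound {3} _ _ = chainPartition-bound chain₃ chain₃-partition
antichain-bound {suc (suc (suc (suc _)))} _ (s≤s (s≤s (s≤s ())))

-- Antichains bounded through their traces.

module _ {I J : Set} {R : I → J → Set} (R? : ∀ i j → Dec (R i j)) where

  trace : (U : List J) → I → Subset (length U)
  trace []      i = []
  trace (u ∷ U) i = does (R? i u) ∷ trace U i

  trace-⊈ : ∀ {i i′} (U : List J) → Any (λ u → R i u × ¬ R i′ u) U → ¬ trace U i ⊆ trace U i′
  trace-⊈ {i} {i′} (u ∷ U) (here (r , ¬r)) sub
    rewrite dec-true (R? i u) r | dec-false (R? i′ u) ¬r with () ← sub Vec.here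
  trace-⊈ (u ∷ U) (there p) sub = trace-⊈ U p (drop-∷-⊆ sub)

  -- The traces of `P` form an antichain in the power set of the positions of `U`. For at most three
  -- positions `antichain-bound` applies, for more the bound `length P ≤ 4` is enough; `U` is
  -- nonempty because every member of `P` hits it.
  separated-bound : (P : List I) (U : List J) → length P ≤ 4 →
                    (∀ {i} → i ∈ P → Any (R i) U) →
                    AllPairs (λ i i′ → Any (λ u → R i u × ¬ R i′ u) U × Any (λ u → R i′ u × ¬ R i u) U) P →
                    length P ≤ length U
  separated-bound []      U       _  _   _   = z≤n
  separated-bound (_ ∷ _) []      _  hit _   with () ← hit (here refl)
  separated-bound P@(_ ∷ _) U@(_ ∷ _) P≤4 _ sep with length U ≤? 3
  ... | no  U≰3 = ≤-trans P≤4 (≰⇒> U≰3)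
  ... | yes U≤3 = subst (_≤ length U) (length-map (trace U) P)
    (antichain-bound (s≤s z≤n) U≤3 (map (trace U) P)
      (AllPairs.map⁺ (AllPairs.map (λ (p , q) → trace-⊈ U p , trace-⊈ U q) sep)))

-- Used to collapse chains of inclusions that begin and end in the same antichain.
antichain-≡ : {L : List (Subset n)} → AllPairs Incomparable L →
              ∀ {a b} → a ∈ L → b ∈ L → a ⊆ b → a ≡ b
antichain-≡ (p ∷ ps) (here refl) (here refl) _   = refl
antichain-≡ (p ∷ ps) (here refl) (there b∈)  a⊆b = ⊥-elim (proj₁ (All.lookup p b∈) a⊆b)
antichain-≡ (p ∷ ps) (there a∈)  (here refl) a⊆b = ⊥-elim (proj₂ (All.lookup p a∈) a⊆b)
antichain-≡ (p ∷ ps) (there a∈)  (there b∈)  a⊆b = antichain-≡ ps a∈ b∈ a⊆b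

incomparable-sym : {X Y : Subset n} → Incomparable X Y → Incomparable Y X
incomparable-sym (p , q) = q , p

module _ (P U : List (Subset n)) (anti : AllPairs Incomparable P) (P≤4 : length P ≤ 4) where

  private
    pairs : {S : Subset n → Subset n → Set} →
            (∀ {b c} → b ∈ P → c ∈ P → Incomparable b c → S b c) → AllPairs S P
    pairs f = go anti id
      where
      go : ∀ {L} → AllPairs Incomparable L → (∀ {b} → b ∈ L → b ∈ P) → AllPairs _ L
      go []       _   = []
      go (p ∷ ps) sub = All.tabulate (λ c∈ → f (sub (here refl)) (sub (there c∈)) (All.lookup p c∈)) ∷ go ps (sub ∘ there)

  -- Members of an antichain which are unions of elements of U have incomparable traces on U.
  unions-bound : (∀ {b} → b ∈ P → ∃[ x ] x Subset.∈ b) →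
                 (∀ {b x} → b ∈ P → x Subset.∈ b → ∃[ X ] (X ∈ U × X ⊆ b × x Subset.∈ X)) →
                 length P ≤ length U
  unions-bound nonempty gen = separated-bound (λ b X → X ⊆? b) P U P≤4
    (λ b∈ → let X , X∈ , X⊆b , _ = gen b∈ (proj₂ (nonempty b∈)) in lose X∈ (λ {y} → X⊆b {y}))
    (pairs λ b∈ c∈ (b⊈c , c⊈b) → sep b∈ b⊈c , sep c∈ c⊈b)
    where
    sep : ∀ {b c} → b ∈ P → ¬ b ⊆ c → Any (λ X → X ⊆ b × ¬ X ⊆ c) U
    sep {b} {c} b∈ b⊈c with ⊈⇒∃ b c b⊈c
    ... | x , x∈b , x∉c with gen b∈ x∈b
    ...   | X , X∈ , X⊆b , x∈X = lose X∈ ((λ {y} → X⊆b {y}) , λ X⊆c → x∉c (X⊆c x∈X))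

  -- Dual to `unions-bound`: members are intersections of elements of `U`, and the trace of `b`
  -- records the elements of `U` above it.
  intersections-bound : (∀ {b} → b ∈ P → ∃[ x ] x Subset.∉ b) →
                        (∀ {b x} → b ∈ P → x Subset.∉ b → ∃[ X ] (X ∈ U × b ⊆ X × x Subset.∉ X)) →
                        length P ≤ length U
  intersections-bound nonfull gen = separated-bound (λ b X → b ⊆? X) P U P≤4
    (λ b∈ → let X , X∈ , b⊆X , _ = gen b∈ (proj₂ (nonfull b∈)) in lose X∈ (λ {y} → b⊆X {y}))
    (pairs λ b∈ c∈ (b⊈c , c⊈b) → sep b∈ c⊈b , sep c∈ b⊈c)
    where
    sep : ∀ {b c} → b ∈ P → ¬ c ⊆ b → Any (λ X → b ⊆ X × ¬ c ⊆ X) U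
    sep {b} {c} b∈ c⊈b with ⊈⇒∃ c b c⊈b
    ... | x , x∈c , x∉b with gen b∈ x∉b
    ...   | X , X∈ , b⊆X , x∉X = lose X∈ ((λ {y} → b⊆X {y}) , λ c⊆X → x∉X (c⊆X x∈c))

-- The order on antichains.

Below Above : List (Subset n) → Subset n → Set
Below A X = Any (X ⊆_) A
Above A X = Any (_⊆ X) A

below? : (A : List (Subset n)) → Decidable (Below A)
below? A X = Any.any? (X ⊆?_) A

above? : (A : List (Subset n)) → Decidable (Above A)
above? A X = Any.any? (_⊆? X) A

below : {A : List (Subset n)} {X a : Subset n} → a ∈ A → X ⊆ a → Below A X
below a∈ X⊆a = lose a∈ (λ {y} → X⊆a {y})

above : {A : List (Subset n)} {X a : Subset n} → a ∈ A → a ⊆ X → Above A X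
above a∈ a⊆X = lose a∈ (λ {y} → a⊆X {y})

infix 4 _≼_ _≺_

-- Compares generated down-sets. Strictness is given by a witness, since distinct lists may be
-- permutations of each other.
_≼_ _≺_ : List (Subset n) → List (Subset n) → Set
A ≼ B = ∀ {a} → a ∈ A → Below B a
A ≺ B = A ≼ B × ∃[ b ] (b ∈ B × ¬ Below A b)

below-mono : {A B : List (Subset n)} {X : Subset n} → A ≼ B → Below A X → Below B X
below-mono A≼B p with find p
... | a , a∈ , X⊆a with find (A≼B a∈)
...   | b , b∈ , a⊆b = below b∈ (⊆-trans X⊆a a⊆b)

level? : (j : ℕ) → Decidable (λ (X : Subset n) → ∣ X ∣ ≡ j)
level? j X = ∣ X ∣ ≟ j

-- For 4-antichains these are the maximal and the minimal elements of the union of `A` and `C`. A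
-- common element occurs once in each: the join takes it from `C`, the meet from `A`.
join meet : List (Subset n) → List (Subset n) → List (Subset n)
join A C = filter (¬? ∘ below? C) A ++ filter (above? A) C
meet A C = filter (below? C) A ++ filter (¬? ∘ above? A) C

-- The lattice of 4-antichains.

module Width {n : ℕ} (𝓕 : List (Subset n)) (no5 : ¬ ContainsAntichain 5 𝓕) where

  open DecMembership (_≟ˢ_ {n}) using () renaming (_∈?_ to _∈ˡ?_)

  antichain≤4 : (L : List (Subset n)) → (∀ {a} → a ∈ L → a ∈ 𝓕) → AllPairs Incomparable L → length L ≤ 4
  antichain≤4 L sub anti with length L ≤? 4
  ... | yes le = le
  ... | no ¬le = ⊥-elim (no5 (take 5 L , trans (length-take 5 L) (m≤n⇒m⊓n≡m (≰⇒> ¬le)) ,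
                              All.take⁺ 5 (All.tabulate sub) , AllPairs.take⁺ 5 anti))

  record Quad (A : List (Subset n)) : Set where
    constructor quad
    field
      len  : length A ≡ 4
      sub  : ∀ {a} → a ∈ A → a ∈ 𝓕
      anti : AllPairs Incomparable A
  open Quad

  -- Otherwise `Y` and `A` together would be five pairwise incomparable sets.
  comparable : ∀ {A Y} → Quad A → Y ∈ 𝓕 → Above A Y ⊎ Below A Y
  comparable {A} {Y} qA Y∈ with above? A Y | below? A Y
  ... | yes p | _     = inj₁ p
  ... | no _  | yes q = inj₂ q
  ... | no ¬p | no ¬q = ⊥-elim (<-irrefl (len qA)
    (antichain≤4 (Y ∷ A) (λ { (here refl) → Y∈ ; (there a∈) → sub qA a∈ })
      (All.tabulate (λ a∈ → (λ Y⊆a → ¬q (below a∈ Y⊆a)) , (λ a⊆Y → ¬p (above a∈ a⊆Y))) ∷ anti qA)))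

  -- With `above⇒≼`, this lets the order be tested from either side: by `comparable`, the only other
  -- case is that `b` lies below `A`, hence below some `b′`, and then all inclusions are equalities.
  ≼⇒above : ∀ {A B} → Quad A → Quad B → A ≼ B → ∀ {b} → b ∈ B → Above A b
  ≼⇒above qA qB A≼B b∈ with comparable qA (sub qB b∈)
  ... | inj₁ p = p
  ... | inj₂ q with find q
  ...   | a , a∈ , b⊆a with find (A≼B a∈)
  ...     | b′ , b′∈ , a⊆b′ = above a∈ (subst (a ⊆_) (sym (antichain-≡ (anti qB) b∈ b′∈ (⊆-trans b⊆a a⊆b′))) a⊆b′)

  above⇒≼ : ∀ {A B} → Quad A → Quad B → (∀ {b} → b ∈ B → Above A b) → A ≼ B
  above⇒≼ qA qB up a∈ with comparable qB (sub qA a∈)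
  ... | inj₂ q = q
  ... | inj₁ p with find p
  ...   | b , b∈ , b⊆a with find (up b∈)
  ...     | a′ , a′∈ , a′⊆b = below b∈ (subst (_⊆ b) (antichain-≡ (anti qA) a′∈ a∈ (⊆-trans a′⊆b b⊆a)) a′⊆b)

  module _ {A C : List (Subset n)} (qA : Quad A) (qC : Quad C) where

    ∈-join : ∀ {x} → x ∈ join A C → (x ∈ A × ¬ Below C x) ⊎ (x ∈ C × Above A x)
    ∈-join x∈ with ∈-++⁻ (filter (¬? ∘ below? C) A) x∈
    ... | inj₁ p = inj₁ (∈-filter⁻ (¬? ∘ below? C) {xs = A} p)
    ... | inj₂ p = inj₂ (∈-filter⁻ (above? A) {xs = C} p)

    ∈-meet : ∀ {x} → x ∈ meet A C → (x ∈ A × Below C x) ⊎ (x ∈ C × ¬ Above A x)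
    ∈-meet x∈ with ∈-++⁻ (filter (below? C) A) x∈
    ... | inj₁ p = inj₁ (∈-filter⁻ (below? C) {xs = A} p)
    ... | inj₂ p = inj₂ (∈-filter⁻ (¬? ∘ above? A) {xs = C} p)

    join-sub : ∀ {x} → x ∈ join A C → x ∈ 𝓕
    join-sub x∈ = [ (λ (p , _) → sub qA p) , (λ (p , _) → sub qC p) ]′ (∈-join x∈)

    meet-sub : ∀ {x} → x ∈ meet A C → x ∈ 𝓕
    meet-sub x∈ = [ (λ (p , _) → sub qA p) , (λ (p , _) → sub qC p) ]′ (∈-meet x∈)

    join-anti : AllPairs Incomparable (join A C)
    join-anti = AllPairs.++⁺ (AllPairs.filter⁺ (¬? ∘ below? C) (anti qA)) (AllPairs.filter⁺ (above? A) (anti qC))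
      (All.tabulate λ {a} a∈ → All.tabulate λ {c} c∈ → go (∈-filter⁻ (¬? ∘ below? C) {xs = A} a∈) (∈-filter⁻ (above? A) {xs = C} c∈))
      where
      go : ∀ {a c} → a ∈ A × ¬ Below C a → c ∈ C × Above A c → Incomparable a c
      go {a} {c} (a∈ , ¬b) (c∈ , ab) = (λ a⊆c → ¬b (below c∈ a⊆c)) , λ c⊆a →
        let a′ , a′∈ , a′⊆c = find ab
        in ¬b (below c∈ (subst (_⊆ c) (antichain-≡ (anti qA) a′∈ a∈ (⊆-trans a′⊆c c⊆a)) a′⊆c))

    meet-anti : AllPairs Incomparable (meet A C)
    meet-anti = AllPairs.++⁺ (AllPairs.filter⁺ (below? C) (anti qA)) (AllPairs.filter⁺ (¬? ∘ above? A) (anti qC))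
      (All.tabulate λ {a} a∈ → All.tabulate λ {c} c∈ → go (∈-filter⁻ (below? C) {xs = A} a∈) (∈-filter⁻ (¬? ∘ above? A) {xs = C} c∈))
      where
      go : ∀ {a c} → a ∈ A × Below C a → c ∈ C × ¬ Above A c → Incomparable a c
      go {a} {c} (a∈ , be) (c∈ , ¬ab) = (λ a⊆c → ¬ab (above a∈ a⊆c)) , λ c⊆a →
        let c′ , c′∈ , a⊆c′ = find be
        in ¬ab (above a∈ (subst (a ⊆_) (sym (antichain-≡ (anti qC) c∈ c′∈ (⊆-trans c⊆a a⊆c′))) a⊆c′))

    length-join+meet : 4 + 4 ≤ length (join A C) + length (meet A C)
    length-join+meet = begin
      4 + 4                            ≡⟨ cong₂ _+_ (len qA) (len qC) ⟨
      length A + length C              ≤⟨ +-mono-≤ (length-filter-cover (¬? ∘ below? C) (below? C) (λ x → swap (toSum (below? C x))) A)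
                                                   (length-filter-cover (above? A) (¬? ∘ above? A) (λ x → toSum (above? A x)) C) ⟩
      (a↑ + a↓) + (c↑ + c↓)            ≡⟨ +-interchange a↑ a↓ c↑ c↓ ⟩
      (a↑ + c↑) + (a↓ + c↓)            ≡⟨ cong₂ _+_ (length-++ (filter (¬? ∘ below? C) A)) (length-++ (filter (below? C) A)) ⟨
      length (join A C) + length (meet A C) ∎
      where
      open ≤-Reasoning
      a↑ = length (filter (¬? ∘ below? C) A)
      a↓ = length (filter (below? C) A)
      c↑ = length (filter (above? A) C)
      c↓ = length (filter (¬? ∘ above? A) C)

    join≤4 : length (join A C) ≤ 4
    join≤4 = antichain≤4 _ join-sub join-anti

    meet≤4 : length (meet A C) ≤ 4
    meet≤4 = antichain≤4 _ meet-sub meet-anti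

    -- `A` and `C` are each divided between join and meet, so the two sizes add up to at least 8,
    -- while neither exceeds 4.
    join-quad : Quad (join A C)
    join-quad = quad (≤-antisym join≤4 (+-cancelʳ-≤ 4 4 _ (≤-trans length-join+meet (+-monoʳ-≤ (length (join A C)) meet≤4)))) join-sub join-anti

    meet-quad : Quad (meet A C)
    meet-quad = quad (≤-antisym meet≤4 (+-cancelˡ-≤ 4 4 _ (≤-trans length-join+meet (+-monoˡ-≤ (length (meet A C)) join≤4)))) meet-sub meet-anti

    ≼-join : A ≼ join A C
    ≼-join = above⇒≼ qA join-quad λ x∈ → [ (λ (p , _) → above p ⊆-refl) , proj₂ ]′ (∈-join x∈)

    meet-≼ : meet A C ≼ C
    meet-≼ x∈ = [ proj₂ , (λ (p , _) → below p ⊆-refl) ]′ (∈-meet x∈)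

    meet-greatest : ∀ {D} → Quad D → D ≼ A → D ≼ C → D ≼ meet A C
    meet-greatest qD D≼A D≼C = above⇒≼ qD meet-quad λ x∈ →
      [ (λ (p , _) → ≼⇒above qD qA D≼A p) , (λ (p , _) → ≼⇒above qD qC D≼C p) ]′ (∈-meet x∈)

    -- A member `x` coming from `A` lies above some `c`, so `x ⊆ X` would give `c ⊆ X`. And `X ⊆ x`
    -- would give `a ⊆ x`, hence `x` equal to `a` and again inside `X`.
    join-incomparable : ∀ {a X} → a ∈ A → a ⊆ X → (∀ {c} → c ∈ C → Incomparable X c) →
                        ∀ {x} → x ∈ join A C → Incomparable X x
    join-incomparable {a} {X} a∈ a⊆X inc {x} x∈ with ∈-join x∈
    ... | inj₂ (p , _)  = inc p
    ... | inj₁ (p , ¬b) with comparable qC (sub qA p)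
    ...   | inj₂ b = ⊥-elim (¬b b)
    ...   | inj₁ c with find c
    ...     | c , c∈ , c⊆x = (λ X⊆x → x⊈X (subst (_⊆ X) (antichain-≡ (anti qA) a∈ p (⊆-trans a⊆X X⊆x)) a⊆X)) , x⊈X
      where
      x⊈X : ¬ x ⊆ X
      x⊈X x⊆X = proj₂ (inc c∈) (⊆-trans c⊆x x⊆X)

    meet-incomparable : ∀ {b X} → b ∈ C → X ⊆ b → (∀ {a} → a ∈ A → Incomparable X a) →
                        ∀ {x} → x ∈ meet A C → Incomparable X x
    meet-incomparable {b} {X} b∈ X⊆b inc {x} x∈ with ∈-meet x∈
    ... | inj₁ (p , _)  = inc p
    ... | inj₂ (p , ¬a) with comparable qA (sub qC p)
    ...   | inj₁ a = ⊥-elim (¬a a)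
    ...   | inj₂ a with find a
    ...     | a , a∈ , x⊆a = X⊈x , λ x⊆X → X⊈x (subst (X ⊆_) (sym (antichain-≡ (anti qC) p b∈ (⊆-trans x⊆X X⊆b))) X⊆b)
      where
      X⊈x : ¬ X ⊆ x
      X⊈x X⊆x = proj₁ (inc a∈) (⊆-trans X⊆x x⊆a)

  -- Consequences of saturation.

  module Saturated (saturate : ∀ {X} → X ∉ 𝓕 → ∃[ C ] (Quad C × (∀ {c} → c ∈ C → Incomparable X c))) where

    comparable-to-all-∈ : ∀ {X} → (∀ Y → Comparable X Y) → X ∈ 𝓕
    comparable-to-all-∈ {X} comp = decidable-stable (X ∈ˡ? 𝓕) λ X∉ → go (saturate X∉)
      where
      go : ¬ (∃[ C ] (Quad C × (∀ {c} → c ∈ C → Incomparable X c)))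
      go (c ∷ _ , _ , inc) with comp c
      ... | inj₁ p = proj₁ (inc (here refl)) p
      ... | inj₂ p = proj₂ (inc (here refl)) p
      go ([] , quad () _ _ , _)

    -- Strictly increasing along `≺` and at most the size of `𝓕`, so it serves as the termination
    -- measure for inductions over the lattice.
    measure : List (Subset n) → ℕ
    measure A = length (filter (below? A) 𝓕)

    measure-< : ∀ {A B} → Quad B → A ≺ B → measure A < measure B
    measure-< {A} {B} qB (A≼B , b , b∈ , ¬below) = begin
      suc (measure A)                     ≡⟨ +-comm 1 _ ⟩
      measure A + 1                       ≤⟨ +-monoʳ-≤ (measure A) (filter-some new? (lose (sub qB b∈) (below b∈ ⊆-refl , ¬below))) ⟩
      measure A + length (filter new? 𝓕)  ≤⟨ filter-disjoint (below? A) new? (below? B) (below-mono A≼B) proj₁ (λ p q → proj₂ q p) 𝓕 ⟩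
      measure B                           ∎
      where
      open ≤-Reasoning
      new? : Decidable (λ X → Below B X × ¬ Below A X)
      new? X = below? B X ×-dec ¬? (below? A X)

    -- For a missing `X`, the meet of `B` with a 4-antichain incomparable to `X` lies strictly below
    -- `B`: none of its members contains `X`, so none contains `b`.
    ∈-below-minimal : ∀ {B} → Quad B → (∀ {C} → Quad C → ¬ C ≺ B) →
                      ∀ {b X} → b ∈ B → X ⊆ b → X ∈ 𝓕
    ∈-below-minimal {B} qB minimal {b} {X} b∈ X⊆b = decidable-stable (X ∈ˡ? 𝓕) λ X∉ →
      let C , qC , inc = saturate X∉
          inc′ = meet-incomparable qC qB b∈ X⊆b inc
      in minimal (meet-quad qC qB) (meet-≼ qC qB , b , b∈ , λ p →
           let m , m∈ , b⊆m = find p in proj₁ (inc′ m∈) (⊆-trans X⊆b b⊆m))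

    -- Take `m` above `a`. If `m` were below `A`, it would equal `a` and lie inside `X`.
    ≺-of-incomparable : ∀ {A M} → Quad A → A ≼ M → ∀ {a X} → a ∈ A → a ⊆ X →
                        (∀ {m} → m ∈ M → Incomparable X m) → A ≺ M
    ≺-of-incomparable {A} qA A≼M {a} {X} a∈ a⊆X inc with find (A≼M a∈)
    ... | m , m∈ , a⊆m = A≼M , m , m∈ , λ p →
      let a′ , a′∈ , m⊆a′ = find p
      in proj₂ (inc m∈) (⊆-trans m⊆a′ (subst (_⊆ X) (antichain-≡ (anti qA) a∈ a′∈ (⊆-trans a⊆m m⊆a′)) a⊆X))

    ∈-above-maximal : ∀ {A} → Quad A → (∀ {C} → Quad C → ¬ A ≺ C) →
                      ∀ {a X} → a ∈ A → a ⊆ X → X ∈ 𝓕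
    ∈-above-maximal {A} qA maximal {a} {X} a∈ a⊆X = decidable-stable (X ∈ˡ? 𝓕) λ X∉ →
      let C , qC , inc = saturate X∉
      in maximal (join-quad qA qC)
           (≺-of-incomparable qA (≼-join qA qC) a∈ a⊆X (join-incomparable qA qC a∈ a⊆X inc))

    ∈-between-cover : ∀ {A B} → Quad A → Quad B → A ≼ B → (∀ {C} → Quad C → A ≺ C → ¬ C ≺ B) →
                      ∀ {a b X} → a ∈ A → b ∈ B → a ⊆ X → X ⊆ b → X ∈ 𝓕
    ∈-between-cover {A} {B} qA qB A≼B cover {a} {b} {X} a∈ b∈ a⊆X X⊆b = decidable-stable (X ∈ˡ? 𝓕) λ X∉ →
      -- The join brings `C` above `A`, the meet brings it below `B`; both preserve incomparability
      -- to `X` because `a ⊆ X ⊆ b`.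
      let C , qC , inc = saturate X∉
          J    = join A C
          qJ   = join-quad qA qC
          qM   = meet-quad qJ qB
          incM = meet-incomparable qJ qB b∈ X⊆b (join-incomparable qA qC a∈ a⊆X inc)
      in cover qM
           (≺-of-incomparable qA (meet-greatest qJ qB qA (≼-join qA qC) A≼B) a∈ a⊆X incM)
           (meet-≼ qJ qB , b , b∈ , λ p →
             let m , m∈ , b⊆m = find p in proj₁ (incM m∈) (⊆-trans X⊆b b⊆m))

    -- Four sets on every inner level.

    module Level (j : ℕ) (0<j : 0 < j) (j<n : j < n) where

      low? : (A : List (Subset n)) → Decidable (λ X → ∣ X ∣ ≡ j × Below A X)
      low? A X = (∣ X ∣ ≟ j) ×-dec below? A X

      large? : Decidable (λ (X : Subset n) → j ≤ ∣ X ∣)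
      large? X = j ≤? ∣ X ∣

      small? : Decidable (λ (X : Subset n) → ∣ X ∣ < j)
      small? X = ∣ X ∣ <? j

      -- The invariant propagated along covers of the lattice.
      Dense : List (Subset n) → Set
      Dense A = length (filter large? A) ≤ length (filter (low? A) 𝓕)

      dense? : Decidable Dense
      dense? A = length (filter large? A) ≤? length (filter (low? A) 𝓕)

      large-nonempty : ∀ {b : Subset n} → j ≤ ∣ b ∣ → ∃[ x ] x Subset.∈ b
      large-nonempty {b} j≤∣b∣ with nonempty? b
      ... | yes ne = ne
      ... | no ¬ne = ⊥-elim (<⇒≱ 0<j (subst (j ≤_) (trans (cong ∣_∣ (Empty-unique ¬ne)) (∣⊥∣≡0 n)) j≤∣b∣))

      small-nonfull : ∀ {a : Subset n} → ∣ a ∣ < j → ∃[ x ] x Subset.∉ a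
      small-nonfull {a} ∣a∣<j with ⊈⇒∃ Subset.⊤ a (λ ⊤⊆a → <⇒≱ (<-trans ∣a∣<j j<n) (subst (_≤ ∣ a ∣) (∣⊤∣≡n n) (p⊆q⇒∣p∣≤∣q∣ ⊤⊆a)))
      ... | x , _ , x∉a = x , x∉a

      quad-split : ∀ {A} → Quad A → 4 ≤ length (filter small? A) + length (filter large? A)
      quad-split {A} qA = ≤-trans (≤-reflexive (sym (len qA))) (length-filter-cover small? large? (λ X → <-≤-connex ∣ X ∣ j) A)

      filter-sub : ∀ {A} {P : Subset n → Set} (P? : Decidable P) → Quad A → ∀ {x} → x ∈ filter P? A → x ∈ 𝓕
      filter-sub P? qA x∈ = sub qA (proj₁ (∈-filter⁻ P? x∈))

      dense-minimal : ∀ {B} → Quad B → (∀ {C} → Quad C → ¬ C ≺ B) → Dense B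
      dense-minimal {B} qB minimal = unions-bound (filter large? B) (filter (low? B) 𝓕) (AllPairs.filter⁺ large? (anti qB))
        (antichain≤4 _ (filter-sub large? qB) (AllPairs.filter⁺ large? (anti qB)))
        (λ b∈ → large-nonempty (proj₂ (∈-filter⁻ large? {xs = B} b∈)))
        gen
        where
        gen : ∀ {b x} → b ∈ filter large? B → x Subset.∈ b → ∃[ X ] (X ∈ filter (low? B) 𝓕 × X ⊆ b × x Subset.∈ X)
        gen {b} b∈ x∈b with ∈-filter⁻ large? {xs = B} b∈
        ... | b∈B , j≤∣b∣ with interpolate-∋ {a = Subset.⊥} {b} {j} ⊥⊆ x∈b (subst (_< j) (sym (∣⊥∣≡0 n)) 0<j) j≤∣b∣
        ...   | X , _ , X⊆b , ∣X∣≡j , x∈X =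
          X , ∈-filter⁺ (low? B) (∈-below-minimal qB minimal b∈B X⊆b) (∣X∣≡j , below b∈B X⊆b) , X⊆b , x∈X

      -- Large members of `B` that contain a small member of `A` are crossing and are paid for by
      -- the j-sets newly below `B`. The others are staying and are paid for by the density of `A`.
      dense-cover : ∀ {A B} → Quad A → Quad B → A ≼ B → (∀ {C} → Quad C → A ≺ C → ¬ C ≺ B) → Dense A → Dense B
      dense-cover {A} {B} qA qB A≼B cover denseA = begin
        length (filter large? B)                                  ≤⟨ filter-cover crossing? staying? large? split B ⟩
        length (filter crossing? B) + length (filter staying? B)  ≤⟨ +-mono-≤ crossing≤ (≤-trans staying≤ denseA) ⟩
        length (filter new? 𝓕) + length (filter (low? A) 𝓕)       ≤⟨ filter-disjoint new? (low? A) (low? B)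
                                                                      (λ (e , p , _) → e , p) (λ (e , p) → e , below-mono A≼B p) (λ (_ , _ , ¬p) (_ , p) → ¬p p) 𝓕 ⟩
        length (filter (low? B) 𝓕)                                ∎
        where
        open ≤-Reasoning
        smallBelow? : Decidable (λ b → Any (λ a → ∣ a ∣ < j × a ⊆ b) A)
        smallBelow? b = Any.any? (λ a → small? a ×-dec (a ⊆? b)) A
        crossing? : Decidable (λ b → j ≤ ∣ b ∣ × Any (λ a → ∣ a ∣ < j × a ⊆ b) A)
        crossing? b = large? b ×-dec smallBelow? b
        staying? : Decidable (λ b → j ≤ ∣ b ∣ × ¬ Any (λ a → ∣ a ∣ < j × a ⊆ b) A)
        staying? b = large? b ×-dec ¬? (smallBelow? b)
        new? : Decidable (λ X → ∣ X ∣ ≡ j × Below B X × ¬ Below A X)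
        new? X = (∣ X ∣ ≟ j) ×-dec (below? B X ×-dec ¬? (below? A X))
        split : ∀ {b} → j ≤ ∣ b ∣ → _ ⊎ _
        split {b} l with smallBelow? b
        ... | yes p = inj₁ (l , p)
        ... | no ¬p = inj₂ (l , ¬p)
        -- Bounding this antichain by 4 does the work of a matching between A and B.
        staying-small : AllPairs Incomparable (filter staying? B ++ filter small? A)
        staying-small = AllPairs.++⁺ (AllPairs.filter⁺ staying? (anti qB)) (AllPairs.filter⁺ small? (anti qA))
          (All.tabulate λ {b} b∈ → All.tabulate λ {a} a∈ →
            let _ , j≤∣b∣ , ¬p = ∈-filter⁻ staying? {xs = B} b∈
                a∈A , ∣a∣<j    = ∈-filter⁻ small? {xs = A} a∈
            in (λ b⊆a → <⇒≱ ∣a∣<j (≤-trans j≤∣b∣ (p⊆q⇒∣p∣≤∣q∣ b⊆a)))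
             , (λ a⊆b → ¬p (lose a∈A (∣a∣<j , λ {y} → a⊆b {y}))))
        staying≤ : length (filter staying? B) ≤ length (filter large? A)
        staying≤ = +-cancelʳ-≤ (length (filter small? A)) _ _ (begin
          length (filter staying? B) + length (filter small? A) ≡⟨ length-++ (filter staying? B) ⟨
          length (filter staying? B ++ filter small? A)         ≤⟨ antichain≤4 _ (λ x∈ → [ filter-sub staying? qB , filter-sub small? qA ]′ (∈-++⁻ (filter staying? B) x∈)) staying-small ⟩
          4                                                     ≤⟨ quad-split qA ⟩
          length (filter small? A) + length (filter large? A)   ≡⟨ +-comm (length (filter small? A)) _ ⟩
          length (filter large? A) + length (filter small? A)   ∎)
        gen : ∀ {b x} → b ∈ filter crossing? B → x Subset.∈ b → ∃[ X ] (X ∈ filter new? 𝓕 × X ⊆ b × x Subset.∈ X)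
        gen {b} b∈ x∈b with ∈-filter⁻ crossing? {xs = B} b∈
        ... | b∈B , j≤∣b∣ , p with find p
        ...   | a , a∈ , ∣a∣<j , a⊆b with interpolate-∋ a⊆b x∈b ∣a∣<j j≤∣b∣
        ...     | X , a⊆X , X⊆b , ∣X∣≡j , x∈X =
          X , ∈-filter⁺ new? (∈-between-cover qA qB A≼B cover a∈ b∈B a⊆X X⊆b) (∣X∣≡j , below b∈B X⊆b , not-below) , X⊆b , x∈X
          where
          not-below : ¬ Below A X
          not-below p with find p
          -- From `a ⊆ X ⊆ a′` the two members of `A` coincide, but `X` has more elements than `a`.
          ... | a′ , a′∈ , X⊆a′ with refl ← antichain-≡ (anti qA) a∈ a′∈ (⊆-trans a⊆X X⊆a′) =
            <⇒≱ ∣a∣<j (subst (_≤ ∣ a ∣) ∣X∣≡j (p⊆q⇒∣p∣≤∣q∣ X⊆a′))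
        crossing≤ : length (filter crossing? B) ≤ length (filter new? 𝓕)
        crossing≤ = unions-bound _ (filter new? 𝓕) (AllPairs.filter⁺ crossing? (anti qB))
          (antichain≤4 _ (filter-sub crossing? qB) (AllPairs.filter⁺ crossing? (anti qB)))
          (λ b∈ → large-nonempty (proj₁ (proj₂ (∈-filter⁻ crossing? {xs = B} b∈))))
          gen

      -- Outer induction on `measure B`. If `B` were not dense, nothing would lie strictly below it:
      -- by induction on the gap in measure, any `A ≺ B` has nothing strictly between, so `B` covers
      -- the dense `A` and is dense. Thus `B` is minimal, hence dense after all. Covers never have
      -- to be constructed.
      dense-all : ∀ k {B} → measure B < k → Quad B → Dense B
      dense-all (suc k) {B} (s≤s μB≤k) qB = decidable-stable (dense? B) λ ¬dense →
        ¬dense (dense-minimal qB (λ qA A≺B → none-below ¬dense (measure B) qA A≺B (m≤m+n _ _)))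
        where
        none-below : ¬ Dense B → ∀ i {A} → Quad A → A ≺ B → measure B ≤ i + measure A → ⊥
        none-below ¬dense zero    qA A≺B gap = <⇒≱ (measure-< qB A≺B) gap
        none-below ¬dense (suc i) {A} qA A≺B gap = ¬dense (dense-cover qA qB (proj₁ A≺B)
          (λ {C} qC A≺C C≺B → none-below ¬dense i qC C≺B
            (≤-trans gap (≤-trans (≤-reflexive (sym (+-suc i _))) (+-monoʳ-≤ i (measure-< qC A≺C)))))
          (dense-all k (<-≤-trans (measure-< qB A≺B) μB≤k) qA))

      -- Large members of `A` are matched by j-sets below `A`, by density. Small members are
      -- intersections of j-sets above them, which lie in `𝓕` by maximality and are not below `A`.
      maximal⇒level≥4 : ∀ {A} → Quad A → (∀ {C} → Quad C → ¬ A ≺ C) → 4 ≤ length (filter (level? j) 𝓕)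
      maximal⇒level≥4 {A} qA maximal = begin
        4                                                        ≤⟨ quad-split qA ⟩
        length (filter small? A) + length (filter large? A)      ≤⟨ +-mono-≤ small≤ (dense-all _ ≤-refl qA) ⟩
        length (filter new? 𝓕) + length (filter (low? A) 𝓕)      ≤⟨ filter-disjoint new? (low? A) (level? j) proj₁ proj₁ (λ (_ , ¬p) (_ , p) → ¬p p) 𝓕 ⟩
        length (filter (level? j) 𝓕)                                 ∎
        where
        open ≤-Reasoning
        new? : Decidable (λ X → ∣ X ∣ ≡ j × ¬ Below A X)
        new? X = (∣ X ∣ ≟ j) ×-dec ¬? (below? A X)
        gen : ∀ {a x} → a ∈ filter small? A → x Subset.∉ a → ∃[ X ] (X ∈ filter new? 𝓕 × a ⊆ X × x Subset.∉ X)
        gen {a} a∈ x∉a with ∈-filter⁻ small? {xs = A} a∈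
        ... | a∈A , ∣a∣<j with interpolate-∌ x∉a (<⇒≤ ∣a∣<j) j<n
        ...   | X , a⊆X , ∣X∣≡j , x∉X = X , ∈-filter⁺ new? (∈-above-maximal qA maximal a∈A a⊆X) (∣X∣≡j , not-below) , a⊆X , x∉X
          where
          not-below : ¬ Below A X
          not-below p with find p
          ... | a′ , a′∈ , X⊆a′ with refl ← antichain-≡ (anti qA) a∈A a′∈ (⊆-trans a⊆X X⊆a′) =
            <⇒≱ ∣a∣<j (subst (_≤ ∣ a ∣) ∣X∣≡j (p⊆q⇒∣p∣≤∣q∣ X⊆a′))
        small≤ : length (filter small? A) ≤ length (filter new? 𝓕)
        small≤ = intersections-bound _ (filter new? 𝓕) (AllPairs.filter⁺ small? (anti qA))
          (antichain≤4 _ (filter-sub small? qA) (AllPairs.filter⁺ small? (anti qA)))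
          (λ a∈ → small-nonfull (proj₂ (∈-filter⁻ small? {xs = A} a∈)))
          gen

      level≥4 : ∀ {A} → Quad A → 4 ≤ length (filter (level? j) 𝓕)
      level≥4 {A} qA = decidable-stable (4 ≤? length (filter (level? j) 𝓕)) λ ¬4≤ → climb ¬4≤ (length 𝓕) qA (m≤m+n _ _)
        where
        -- The number `i` bounds the remaining climb, `length 𝓕` minus `measure A`; at 0 the
        -- antichain is maximal.
        climb : ¬ 4 ≤ length (filter (level? j) 𝓕) → ∀ i {A} → Quad A → length 𝓕 ≤ i + measure A → ⊥
        climb ¬4≤ zero qA gap = ¬4≤ (maximal⇒level≥4 qA λ {C} qC A≺C →
          <⇒≱ (measure-< qC A≺C) (≤-trans (length-filter (below? C) 𝓕) gap))
        climb ¬4≤ (suc i) qA gap = ¬4≤ (maximal⇒level≥4 qA λ {C} qC A≺C →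
          climb ¬4≤ i qC (≤-trans gap (≤-trans (≤-reflexive (sym (+-suc i _))) (+-monoʳ-≤ i (measure-< qC A≺C)))))

-- Extending a family by one set.

-- Turns saturation into a 4-antichain of `𝓕` incomparable to `X`. The components `X ∈ L` and
-- `All (_∈ L) C` serve the recursion: they make a head from `𝓕` incomparable to `X` and to `C`.
remove-new : {𝓕 : List (Subset n)} {X : Subset n} {L : List (Subset n)} →
             All (_∈ X ∷ 𝓕) L → AllPairs Incomparable L →
             All (_∈ 𝓕) L ⊎ (X ∈ L × ∃[ C ] (length L ≡ suc (length C) × All (_∈ L) C × All (_∈ 𝓕) C ×
                                              AllPairs Incomparable C × All (Incomparable X) C))
remove-new [] [] = inj₁ []
remove-new {𝓕 = 𝓕} {X} {_ ∷ L} (here refl ∷ ms) (p ∷ ps) =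
  inj₂ (here refl , L , refl , All.tabulate there , All.tabulate old , ps , p)
  where
  old : ∀ {Y} → Y ∈ L → Y ∈ 𝓕
  old Y∈ with All.lookup ms Y∈
  ... | here refl = ⊥-elim (proj₁ (All.lookup p Y∈) ⊆-refl)
  ... | there Y∈𝓕 = Y∈𝓕
remove-new {L = Y ∷ L} (there Y∈𝓕 ∷ ms) (p ∷ ps) with remove-new ms ps
... | inj₁ all = inj₁ (Y∈𝓕 ∷ all)
... | inj₂ (X∈L , C , len , C⊆L , C⊆𝓕 , anti , inc) =
  inj₂ (there X∈L , Y ∷ C , cong suc len , here refl ∷ All.map there C⊆L , Y∈𝓕 ∷ C⊆𝓕 ,
        All.map (All.lookup p) C⊆L ∷ anti , incomparable-sym (All.lookup p X∈L) ∷ inc)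

-- The size of a family in terms of its levels.

module _ (𝓕 : List (Subset n)) where

  below-level? : (j : ℕ) → Decidable (λ (X : Subset n) → ∣ X ∣ < j)
  below-level? j X = ∣ X ∣ <? j

  level below-level : ℕ → ℕ
  level j       = length (filter (level? j) 𝓕)
  below-level j = length (filter (below-level? j) 𝓕)

  below-level-suc-≥ : ∀ j → below-level j + level j ≤ below-level (suc j)
  below-level-suc-≥ j = filter-disjoint (below-level? j) (level? j) (below-level? (suc j))
    m<n⇒m<1+n (s≤s ∘ ≤-reflexive) <⇒≢ 𝓕

  below-level-suc-≤ : ∀ j → below-level (suc j) ≤ below-level j + level j
  below-level-suc-≤ j = filter-cover (below-level? j) (level? j) (below-level? (suc j))
    (λ l → m≤n⇒m<n∨m≡n (≤-pred l)) 𝓕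

  -- The count is 1 + 4(n - 1) + 1: one set at each end and four on each of the n - 1 levels
  -- between.
  length-≥-levels : 0 < n → 1 ≤ level 0 → (∀ j → 0 < j → j < n → 4 ≤ level j) → 1 ≤ level n →
                    4 * n ∸ 2 ≤ length 𝓕
  length-≥-levels (s≤s {n = m} _) bot mid top = begin
    4 * suc m ∸ 2                   ≡⟨ cong (_∸ 2) (*-suc 4 m) ⟩
    2 + 4 * m                       ≡⟨ +-comm 1 _ ⟩
    1 + 4 * m + 1                   ≤⟨ +-mono-≤ (go m ≤-refl) top ⟩
    below-level n + level n         ≤⟨ below-level-suc-≥ n ⟩
    below-level (suc n)             ≤⟨ length-filter (below-level? (suc n)) 𝓕 ⟩
    length 𝓕                        ∎
    where
    open ≤-Reasoning
    go : ∀ j → j < n → 1 + 4 * j ≤ below-level (suc j)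
    go zero    _   = ≤-trans bot (≤-trans (m≤n+m _ (below-level 0)) (below-level-suc-≥ 0))
    go (suc j) j<n = begin
      1 + 4 * suc j                        ≡⟨ cong suc (trans (*-suc 4 j) (+-comm 4 _)) ⟩
      1 + 4 * j + 4                        ≤⟨ +-mono-≤ (go j (<⇒≤ j<n)) (mid (suc j) (s≤s z≤n) j<n) ⟩
      below-level (suc j) + level (suc j)  ≤⟨ below-level-suc-≥ (suc j) ⟩
      below-level (suc (suc j))            ∎

  length-≤-levels : 0 < n → level 0 ≤ 1 → (∀ j → level j ≤ 4) → level n ≤ 1 →
                    length 𝓕 ≤ 4 * n ∸ 2
  length-≤-levels (s≤s {n = m} _) bot mid top = begin
    length 𝓕                        ≤⟨ length-filter-cover (below-level? n) (level? n) (λ X → m≤n⇒m<n∨m≡n (∣p∣≤n X)) 𝓕 ⟩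
    below-level n + level n         ≤⟨ +-mono-≤ (go m) top ⟩
    1 + 4 * m + 1                   ≡⟨ +-comm 1 _ ⟨
    2 + 4 * m                       ≡⟨ cong (_∸ 2) (*-suc 4 m) ⟨
    4 * suc m ∸ 2                   ∎
    where
    open ≤-Reasoning
    none : ∀ L → length (filter (below-level? 0) L) ≡ 0
    none []      = refl
    none (_ ∷ L) = none L
    go : ∀ j → below-level (suc j) ≤ 1 + 4 * j
    go zero    = ≤-trans (below-level-suc-≤ 0) (+-mono-≤ (≤-reflexive (none 𝓕)) bot)
    go (suc j) = begin
      below-level (suc (suc j))            ≤⟨ below-level-suc-≤ (suc j) ⟩
      below-level (suc j) + level (suc j)  ≤⟨ +-mono-≤ (go j) (mid (suc j)) ⟩
      1 + 4 * j + 4                        ≡⟨ cong suc (trans (*-suc 4 j) (+-comm 4 _)) ⟨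
      1 + 4 * suc j                        ∎

unique-constant : {A : Set} {xs : List A} → Unique xs → (∀ {x y} → x ∈ xs → y ∈ xs → x ≡ y) → length xs ≤ 1
unique-constant [] _ = z≤n
unique-constant (_ ∷ []) _ = s≤s z≤n
unique-constant ((x≢y ∷ _) ∷ _ ∷ _) const = ⊥-elim (x≢y (const (here refl) (there (here refl))))

∣p∣≡0⇒p≡⊥ : {X : Subset n} → ∣ X ∣ ≡ 0 → X ≡ Subset.⊥
∣p∣≡0⇒p≡⊥ {n} {X} e = sym (⊆∧∣≥∣⇒≡ (⊥⊆ {p = X}) (≤-reflexive (trans e (sym (∣⊥∣≡0 n)))))

-- Lower and upper bound.

length-≥ : 5 ≤ n → (𝓕 : List (Subset n)) → AntichainSaturated 5 𝓕 → 4 * n ∸ 2 ≤ length 𝓕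
length-≥ {n} 5≤n 𝓕 (_ , no5 , sat) = length-≥-levels 𝓕 (≤-trans (s≤s z≤n) 5≤n)
  (filter-some (level? 0) (lose (comparable-to-all-∈ (λ Y → inj₁ ⊥⊆)) (∣⊥∣≡0 n)))
  (λ j 0<j j<n → Level.level≥4 j 0<j j<n (proj₂ some-quad))
  (filter-some (level? n) (lose (comparable-to-all-∈ (λ Y → inj₂ ⊆⊤)) (∣⊤∣≡n n)))
  where
  open Width 𝓕 no5
  open DecMembership (_≟ˢ_ {n}) using () renaming (_∈?_ to _∈ˡ?_)
  saturate : ∀ {X} → X ∉ 𝓕 → ∃[ C ] (Quad C × (∀ {c} → c ∈ C → Incomparable X c))
  saturate {X} X∉ with sat X X∉
  ... | L , len , L⊆ , anti with remove-new L⊆ anti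
  ...   | inj₁ L⊆𝓕 = ⊥-elim (no5 (L , len , L⊆𝓕 , anti))
  ...   | inj₂ (_ , C , len′ , _ , C⊆𝓕 , antiC , inc) =
    C , quad (suc-injective (trans (sym len′) len)) (All.lookup C⊆𝓕) antiC , All.lookup inc
  open Saturated saturate
  singletons-incomparable : {x y : Fin n} → x ≢ y → Incomparable ⁅ x ⁆ ⁅ y ⁆
  singletons-incomparable {x} {y} x≢y =
    (λ s → x≢y (x∈⁅y⁆⇒x≡y y (s (x∈⁅x⁆ x)))) , (λ s → x≢y (sym (x∈⁅y⁆⇒x≡y x (s (x∈⁅x⁆ y)))))
  -- The n ≥ 5 singletons are pairwise incomparable, so one is missing from `𝓕`, and saturation at
  -- it yields a 4-antichain.
  some-quad : ∃[ A ] Quad A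
  some-quad with Fin.all? (λ x → ⁅ x ⁆ ∈ˡ? 𝓕)
  ... | no ¬all with Fin.¬∀⟶∃¬ n _ (λ x → ⁅ x ⁆ ∈ˡ? 𝓕) ¬all
  ...   | x , x∉ with saturate x∉
  ...     | C , qC , _ = C , qC
  some-quad | yes all = ⊥-elim (<⇒≱ 5≤n (subst (_≤ 4) (length-tabulate (⁅_⁆ {n}))
    (antichain≤4 (tabulate ⁅_⁆) (All.lookup (All.tabulate⁺ all)) (AllPairs.tabulate⁺ singletons-incomparable))))

length-≤ : 0 < n → (𝓕 : List (Subset n)) → Unique 𝓕 → ¬ ContainsAntichain 5 𝓕 → length 𝓕 ≤ 4 * n ∸ 2
length-≤ {n} 0<n 𝓕 uniq no5 = length-≤-levels 𝓕 0<n
  (constant 0 (λ e e′ → trans (∣p∣≡0⇒p≡⊥ e) (sym (∣p∣≡0⇒p≡⊥ e′))))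
  (λ j → antichain≤4 _ (λ x∈ → proj₁ (∈-filter⁻ (level? j) x∈)) (level-anti j))
  (constant n (λ e e′ → trans (∣p∣≡n⇒p≡⊤ e) (sym (∣p∣≡n⇒p≡⊤ e′))))
  where
  open Width 𝓕 no5
  constant : ∀ j → (∀ {X Y : Subset n} → ∣ X ∣ ≡ j → ∣ Y ∣ ≡ j → X ≡ Y) → level 𝓕 j ≤ 1
  constant j eq = unique-constant (AllPairs.filter⁺ (level? j) uniq)
    (λ x∈ y∈ → eq (proj₂ (∈-filter⁻ (level? j) {xs = 𝓕} x∈)) (proj₂ (∈-filter⁻ (level? j) {xs = 𝓕} y∈)))
  equal-size : ∀ j {L} → All (λ X → ∣ X ∣ ≡ j) L → Unique L → AllPairs Incomparable L
  equal-size j [] [] = []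
  equal-size j (e ∷ es) (X≢ ∷ uniq) = All.zipWith
    (λ (e′ , X≢Y) → ≢∧∣≡∣⇒incomparable X≢Y (trans e (sym e′)))
    (es , X≢) ∷ equal-size j es uniq
  level-anti : ∀ j → AllPairs Incomparable (filter (level? j) 𝓕)
  level-anti j = equal-size j (All.all-filter (level? j) 𝓕) (AllPairs.filter⁺ (level? j) uniq)

-- Existence by greedy saturation.

incomparable? : (X Y : Subset n) → Dec (Incomparable X Y)
incomparable? X Y = ¬? (X ⊆? Y) ×-dec ¬? (Y ⊆? X)

tuple? : {A : Set} (k : ℕ) (xs : List A) {Q : List A → Set} → Decidable Q →
         Dec (∃[ L ] (length L ≡ k × All (_∈ xs) L × Q L))
tuple? zero xs {Q} Q? = map′ (λ q → [] , refl , [] , q) (λ { ([] , _ , _ , q) → q }) (Q? [])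
tuple? (suc k) xs {Q} Q? = map′ to from (Any.any? (λ x → tuple? k xs (Q? ∘ (x ∷_))) xs)
  where
  to : Any (λ x → ∃[ L ] (length L ≡ k × All (_∈ xs) L × Q (x ∷ L))) xs →
       ∃[ L ] (length L ≡ suc k × All (_∈ xs) L × Q L)
  to p with find p
  ... | x , x∈ , L , len , L⊆ , q = x ∷ L , cong suc len , x∈ ∷ L⊆ , q
  from : ∃[ L ] (length L ≡ suc k × All (_∈ xs) L × Q L) →
         Any (λ x → ∃[ L ] (length L ≡ k × All (_∈ xs) L × Q (x ∷ L))) xs
  from (x ∷ L , len , x∈ ∷ L⊆ , q) = lose x∈ (L , suc-injective len , L⊆ , q)

containsAntichain? : (k : ℕ) (𝓕 : List (Subset n)) → Dec (ContainsAntichain k 𝓕)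
containsAntichain? k 𝓕 = tuple? k 𝓕 (AllPairs.allPairs? incomparable?)

containsAntichain-mono : ∀ {k} {𝓕 𝓖 : List (Subset n)} → (∀ {X} → X ∈ 𝓕 → X ∈ 𝓖) →
                         ContainsAntichain k 𝓕 → ContainsAntichain k 𝓖
containsAntichain-mono f (L , len , L⊆ , anti) = L , len , All.map f L⊆ , anti

-- Each set of `xs` is added unless it completes a k-antichain. A rejected set stays rejected
-- because the family only grows, which is why the conclusion records that `𝓖` contains `𝓕`.
saturate-greedily : ∀ k (xs 𝓕 : List (Subset n)) → Unique 𝓕 → ¬ ContainsAntichain k 𝓕 →
  ∃[ 𝓖 ] (Unique 𝓖 × ¬ ContainsAntichain k 𝓖 × (∀ {X} → X ∈ 𝓕 → X ∈ 𝓖) ×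
          (∀ {X} → X ∈ xs → X ∉ 𝓖 → ContainsAntichain k (X ∷ 𝓖)))
saturate-greedily k [] 𝓕 uniq free = 𝓕 , uniq , free , id , λ ()
saturate-greedily k (x ∷ xs) 𝓕 uniq free with containsAntichain? k (x ∷ 𝓕) | DecMembership._∈?_ _≟ˢ_ x 𝓕
... | yes anti | _ with saturate-greedily k xs 𝓕 uniq free
...   | 𝓖 , uniq′ , free′ , 𝓕⊆𝓖 , sat = 𝓖 , uniq′ , free′ , 𝓕⊆𝓖 , λ
        { (here refl) _  → containsAntichain-mono (λ { (here e) → here e ; (there Y∈) → there (𝓕⊆𝓖 Y∈) }) anti
        ; (there X∈)  X∉ → sat X∈ X∉ }
saturate-greedily k (x ∷ xs) 𝓕 uniq free | no _ | yes x∈𝓕 with saturate-greedily k xs 𝓕 uniq free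
... | 𝓖 , uniq′ , free′ , 𝓕⊆𝓖 , sat = 𝓖 , uniq′ , free′ , 𝓕⊆𝓖 , λ
      { (here refl) x∉ → ⊥-elim (x∉ (𝓕⊆𝓖 x∈𝓕)) ; (there X∈) X∉ → sat X∈ X∉ }
saturate-greedily k (x ∷ xs) 𝓕 uniq free | no free₁ | no x∉𝓕
  with saturate-greedily k xs (x ∷ 𝓕) (All.tabulate (λ Y∈ x≡Y → x∉𝓕 (subst (_∈ 𝓕) (sym x≡Y) Y∈)) ∷ uniq) free₁
... | 𝓖 , uniq′ , free′ , 𝓕⊆𝓖 , sat = 𝓖 , uniq′ , free′ , 𝓕⊆𝓖 ∘ there , λ
      { (here refl) x∉ → ⊥-elim (x∉ (𝓕⊆𝓖 (here refl))) ; (there X∈) X∉ → sat X∈ X∉ }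

theorem2 : (n : ℕ) → 5 ≤ n → SatStarIs n 5 (4 * n ∸ 2)
theorem2 n 5≤n with saturate-greedily 5 (subsets n) [] [] (λ { (_ ∷ _ , _ , () ∷ _ , _) })
... | 𝓖 , uniq , free , _ , sat =
  -- The two bounds force the size of whatever family the greedy pass produces.
  (𝓖 , saturated , ≤-antisym (length-≤ (≤-trans (s≤s z≤n) 5≤n) 𝓖 uniq free) (length-≥ 5≤n 𝓖 saturated)) , length-≥ 5≤n
  where
  saturated : AntichainSaturated 5 𝓖
  saturated = uniq , free , λ X → sat (∈-subsets X)
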